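{- Let $(W,S,*)$ be a twisted Coxeter system with $W$ finite, and let $w_0$ be the longest element of $W$. Let $x,y \in \mathcal{I}_*$ with $x \leq_{T,*} y$. If either $\ell(x) = \hat\ell_*(x)$ or $\ell(w_0)-\ell(y) = \hat\ell_*(w_0)-\hat\ell_*(y)$, then $\mathcal{A}_*(x,y) = \mathcal{A}'_*(x,y)$.
   Context: A twisted Coxeter system $(W,S,*)$ is a Coxeter system $(W,S)$ with length function $\ell$ together with an automorphism $*$ of $W$ (written $w\mapsto w^*$) satisfying $S^*=S$ and $(w^*)^*=w$. Let $\mathcal{I}_*=\{w\in W: w^{ -1}=w^*\}$. The Demazure product $\circ$ is the unique associative operation on $W$ with $s\circ w = sw$ if $\ell(sw)>\ell(w)$ and $s\circ w=w$ otherwise, and $w\circ s=ws$ if $\ell(ws)>\ell(w)$ and $w\circ s = w$ otherwise, for $s\in S$, $w\in W$. For $x,w\in W$ put $x\ltimes_* w = (w^*)^{ -1}\circ x\circ w$. For $x,y\in\mathcal{I}_*$, $\mathcal{B}_*(x,y)=\{w\in W: x\ltimes_* w = y\}$ and $\mathcal{A}_*(x,y)$ is the set of minimal-length elements of $\mathcal{B}_*(x,y)$. For $x\in\mathcal{I}_*$, $\hat\ell_*(x)$ is the minimum of $\ell(w)$ over $w\in W$ with $1\ltimes_* w = x$. For $x\in\mathcal{I}_*$ and $s\in S$ let $x\rtimes_* s = s^*xs$ if $s^*x\ne xs$ and $x\rtimes_* s = xs$ if $s^*x=xs$. The order $\leq_{T,*}$ on $\mathcal{I}_*$ is the reflexive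 transitive closure of the relation $w <_{T,*} w\rtimes_* s$ for $w\in\mathcal{I}_*$, $s\in S$ with $\hat\ell_*(w)<\hat\ell_*(w\rtimes_* s)$. Let $\leq$ be the Bruhat order on $W$. $\mathcal{A}'_*(x,y)$ denotes the set of minimal-length elements of $\mathcal{B}'_*(x,y)=\{w\in W: w^*y\leq xw\}$. -}

module Defs where

open import Level using (0ℓ)
open import Algebra.Bundles using (Group)
open import Data.Nat using (ℕ; zero; suc; _≤_; _<_; _+_)
open import Data.Fin using (Fin)
open import Data.List using (List; []; _∷_; foldr; length)
open import Data.List.Membership.Propositional using (_∈_)
open import Data.Product using (Σ; ∃; _×_; _,_)
open import Data.Sum using (_⊎_)
open import Relation.Nullary using (¬_)
open import Relation.Binary.PropositionalEquality using (_≡_; _≢_)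
open import Relation.Binary.Construct.Closure.ReflexiveTransitive using (Star)

pow : {A : Set} → (A → A → A) → A → A → ℕ → A
pow _∙_ u a zero = u
pow _∙_ u a (suc k) = a ∙ pow _∙_ u a k

-- A twisted Coxeter system (W,S,*).
-- W is a group (with propositional equality), S = {gen i | i : Fin n}
-- is a (finite) set of involutions generating W such that W has the
-- Coxeter presentation < S | (st)^{m(s,t)} = 1 >, where m(s,t) is the order
-- of st in W: expressed by the universal property of the presentation
-- (every assignment of S into a group satisfying all relations
-- (st)^k = 1 that hold in W extends to a homomorphism).
-- ℓ is the length function (pinned down uniquely by its two axioms),
-- and star is an involutive group automorphism of W with S^* = S.
record TwistedCoxeterSystem : Set₁ where
  infixl 7 _·_
  infix 8 _⁻¹
  field
    W     : Set
    _·_   : W → W → W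
    e     : W
    _⁻¹   : W → W
    ·-assoc    : ∀ a b c → (a · b) · c ≡ a · (b · c)
    ·-identityˡ : ∀ a → e · a ≡ a
    ·-identityʳ : ∀ a → a · e ≡ a
    ·-inverseˡ  : ∀ a → (a ⁻¹) · a ≡ e
    ·-inverseʳ  : ∀ a → a · (a ⁻¹) ≡ e
    n     : ℕ
    gen   : Fin n → W
    gen-injective  : ∀ i j → gen i ≡ gen j → i ≡ j
    gen-involution : ∀ i → gen i · gen i ≡ e
    gen-nontrivial : ∀ i → gen i ≢ e
    generates : ∀ w → ∃ λ (ws : List (Fin n)) → foldr (λ i v → gen i · v) e ws ≡ w
    presentation :
      (H : Group 0ℓ 0ℓ) (f : Fin n → Group.Carrier H) →
      (∀ i j k → pow _·_ e (gen i · gen j) k ≡ e →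
         Group._≈_ H (pow (Group._∙_ H) (Group.ε H) (Group._∙_ H (f i) (f j)) k) (Group.ε H)) →
      Σ (W → Group.Carrier H) λ φ →
        (∀ a b → Group._≈_ H (φ (a · b)) (Group._∙_ H (φ a) (φ b))) ×
        (∀ i → Group._≈_ H (φ (gen i)) (f i))
    ℓ : W → ℕ
    ℓ-attained : ∀ w → ∃ λ (ws : List (Fin n)) →
      (foldr (λ i v → gen i · v) e ws ≡ w) × (length ws ≡ ℓ w)
    ℓ-minimal : ∀ (ws : List (Fin n)) → ℓ (foldr (λ i v → gen i · v) e ws) ≤ length ws
    star : W → W
    star-hom    : ∀ a b → star (a · b) ≡ star a · star b
    star-invol  : ∀ a → star (star a) ≡ a
    star-gen    : ∀ i → ∃ λ j → star (gen i) ≡ gen j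

  IsFinite : Set
  IsFinite = Σ (List W) λ xs → ∀ w → w ∈ xs

  IsLongest : W → Set
  IsLongest w₀ = ∀ w → ℓ w ≤ ℓ w₀

  Inv : W → Set
  Inv w = w ⁻¹ ≡ star w

  IsReflection : W → Set
  IsReflection t = ∃ λ g → ∃ λ i → t ≡ g · gen i · (g ⁻¹)

  BruhatStep : W → W → Set
  BruhatStep u v = ∃ λ t → IsReflection t × (v ≡ u · t) × (ℓ u < ℓ v)

  _≤B_ : W → W → Set
  _≤B_ = Star BruhatStep

-- The Demazure product: the (unique) associative operation with the
-- stated behaviour on simple generators from the left and from the right.
record DemazureProduct (C : TwistedCoxeterSystem) : Set where
  open TwistedCoxeterSystem C
  field
    _∘_ : W → W → W
    ∘-assoc : ∀ a b c → (a ∘ b) ∘ c ≡ a ∘ (b ∘ c)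
    ∘-left-up    : ∀ i w → ℓ w < ℓ (gen i · w) → gen i ∘ w ≡ gen i · w
    ∘-left-down  : ∀ i w → ¬ (ℓ w < ℓ (gen i · w)) → gen i ∘ w ≡ w
    ∘-right-up   : ∀ i w → ℓ w < ℓ (w · gen i) → w ∘ gen i ≡ w · gen i
    ∘-right-down : ∀ i w → ¬ (ℓ w < ℓ (w · gen i)) → w ∘ gen i ≡ w

module Twisted (C : TwistedCoxeterSystem) (D : DemazureProduct C) where
  open TwistedCoxeterSystem C
  open DemazureProduct D

  _⋉_ : W → W → W
  x ⋉ w = (((star w) ⁻¹) ∘ x) ∘ w

  B : W → W → W → Set
  B x y w = x ⋉ w ≡ y

  MinLen : (W → Set) → W → Set
  MinLen P w = P w × (∀ v → P v → ℓ w ≤ ℓ v)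

  A : W → W → W → Set
  A x y = MinLen (B x y)

  B′ : W → W → W → Set
  B′ x y w = (star w · y) ≤B (x · w)

  A′ : W → W → W → Set
  A′ x y = MinLen (B′ x y)

  ℓ̂≡ : W → ℕ → Set
  ℓ̂≡ x k = (∃ λ w → (e ⋉ w ≡ x) × (ℓ w ≡ k)) × (∀ w → e ⋉ w ≡ x → k ≤ ℓ w)

  IsTwistedAct : W → Fin n → W → Set
  IsTwistedAct w i v =
    ((star (gen i) · w ≢ w · gen i) × (v ≡ star (gen i) · w · gen i)) ⊎
    ((star (gen i) · w ≡ w · gen i) × (v ≡ w · gen i))

  TStep : W → W → Set
  TStep w v = Inv w × (∃ λ i → IsTwistedAct w i v) ×
              (∃ λ a → ∃ λ b → ℓ̂≡ w a × ℓ̂≡ v b × a < b)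

  _≤T_ : W → W → Set
  _≤T_ = Star TStep

module Submission where

-- If w* y ≤ x w in Bruhat order, then y ≤ (w*)⁻¹ ∘ x ∘ w = x ⋉ w, because c a ≤ c ∘ a and
-- the Demazure product is monotone.  The Bruhat order on twisted involutions is compatible
-- with ℓ̂, so ℓ̂(y) ≤ ℓ̂(x ⋉ w) ≤ ℓ̂(x) + ℓ(w), with equality throughout only if y = x ⋉ w;
-- and x ≤T y provides an element of B(x,y) of length ℓ̂(y) - ℓ̂(x).  Conversely, along a
-- minimal w ∈ A(x,y) every letter is an ascent, and w* (x ⋉ w) ≤ x w follows letter by
-- letter from the monotonicity of u ↦ max(u, u s).
-- The strong exchange property behind the monotonicity comes from the inversion cocycle
-- N : W → (W → Bool), which the universal property of the presentation supplies.

open import Defs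
open import Algebra.Bundles using (Group)
import Algebra.Properties.Group as GroupProperties
open import Data.Bool using (Bool; true; false; _xor_)
open import Data.Bool.Properties using (xor-assoc; xor-same; xor-identityʳ)
open import Data.Empty using (⊥-elim)
open import Data.Fin using (Fin)
open import Data.List using (List; []; _∷_; _++_; foldr; length)
open import Data.List.Properties using (length-++)
import Data.Nat as ℕ
open import Data.Nat using (ℕ; zero; suc; _+_; _≤_; _<_; z≤n; s≤s)
open import Data.Nat.Properties hiding (_≟_)
open import Data.Product using (∃; _×_; _,_; proj₁; proj₂)
open import Data.Sum using (_⊎_; inj₁; inj₂; [_,_]′)
open import Function.Bundles using (_⇔_; mk⇔)
open import Level using (0ℓ)
open import Relation.Binary.Construct.Closure.ReflexiveTransitive using (Star; _◅_; _◅◅_; kleisliStar)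
  renaming (ε to done)
open import Relation.Binary.PropositionalEquality hiding ([_])
open import Relation.Nullary using (¬_; Dec; yes; no; does)
open import Relation.Nullary.Decidable using (map′; does-⇔; dec-true; dec-false)

-- Sums modulo 2 of Boolean sequences.

xorSum : (ℕ → Bool) → ℕ → Bool
xorSum f zero    = false
xorSum f (suc n) = f 0 xor xorSum (λ m → f (suc m)) n

xorSum-cong : ∀ {f g : ℕ → Bool} → (∀ m → f m ≡ g m) → ∀ n → xorSum f n ≡ xorSum g n
xorSum-cong f≗g zero    = refl
xorSum-cong f≗g (suc n) = cong₂ _xor_ (f≗g 0) (xorSum-cong (λ m → f≗g (suc m)) n)

xorSum-+ : ∀ f k n → xorSum f (k + n) ≡ xorSum f k xor xorSum (λ m → f (k + m)) n
xorSum-+ f zero    n = refl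
xorSum-+ f (suc k) n = trans (cong (f 0 xor_) (xorSum-+ (λ m → f (suc m)) k n))
                             (sym (xor-assoc (f 0) _ _))

xorSum-periodic : ∀ f k → (∀ m → f (k + m) ≡ f m) → xorSum f (k + k) ≡ false
xorSum-periodic f k per = trans (xorSum-+ f k k)
  (trans (cong (xorSum f k xor_) (xorSum-cong per k)) (xor-same (xorSum f k)))

-- Group identities and conjugation.

module Coxeter (C : TwistedCoxeterSystem) where
  open TwistedCoxeterSystem C

  W-group : Group 0ℓ 0ℓ
  W-group = record
    { Carrier = W ; _≈_ = _≡_ ; _∙_ = _·_ ; ε = e ; _⁻¹ = _⁻¹
    ; isGroup = record
      { isMonoid = record
        { isSemigroup = record
          { isMagma = record { isEquivalence = isEquivalence ; ∙-cong = cong₂ _·_ }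
          ; assoc = ·-assoc }
        ; identity = ·-identityˡ , ·-identityʳ }
      ; inverse = ·-inverseˡ , ·-inverseʳ
      ; ⁻¹-cong = cong _⁻¹ } }

  open GroupProperties W-group public

  private
    variable
      u v w t : W

  word : List (Fin n) → W
  word = foldr (λ i v → gen i · v) e

  gen⁻¹ : ∀ i → gen i ⁻¹ ≡ gen i
  gen⁻¹ i = sym (inverseˡ-unique _ _ (gen-involution i))

  gen-cancelˡ : ∀ i w → gen i · (gen i · w) ≡ w
  gen-cancelˡ i w = trans (sym (·-assoc _ _ _)) (trans (cong (_· w) (gen-involution i)) (·-identityˡ w))

  gen-cancelʳ : ∀ i w → (w · gen i) · gen i ≡ w
  gen-cancelʳ i w = trans (·-assoc _ _ _) (trans (cong (w ·_) (gen-involution i)) (·-identityʳ w))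

  -- A right action of the group, as the cocycle law `N-·` requires.
  conj : W → W → W
  conj g r = g ⁻¹ · (r · g)

  ·-conj : ∀ g r → g · conj g r ≡ r · g
  ·-conj g r = \\-leftDividesˡ g (r · g)

  conj-unique : ∀ g r q → g · q ≡ r · g → conj g r ≡ q
  conj-unique g r q eq = trans (cong (g ⁻¹ ·_) (sym eq)) (\\-leftDividesʳ g q)

  conj-e : ∀ r → conj e r ≡ r
  conj-e r = conj-unique e r r (trans (·-identityˡ r) (sym (·-identityʳ r)))

  conj-· : ∀ g h r → conj (g · h) r ≡ conj h (conj g r)
  conj-· g h r = conj-unique (g · h) r _ (begin
    (g · h) · conj h (conj g r)   ≡⟨ ·-assoc g h _ ⟩
    g · (h · conj h (conj g r))   ≡⟨ cong (g ·_) (·-conj h _) ⟩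
    g · (conj g r · h)            ≡⟨ ·-assoc g _ h ⟨
    (g · conj g r) · h            ≡⟨ cong (_· h) (·-conj g r) ⟩
    (r · g) · h                   ≡⟨ ·-assoc r g h ⟩
    r · (g · h)                   ∎)
    where open ≡-Reasoning

  conj-cancel : ∀ g r → conj (g ⁻¹) (conj g r) ≡ r
  conj-cancel g r = trans (sym (conj-· g (g ⁻¹) r)) (trans (cong (λ h → conj h r) (·-inverseʳ g)) (conj-e r))

  conj-cancel′ : ∀ g r → conj g (conj (g ⁻¹) r) ≡ r
  conj-cancel′ g r = trans (sym (conj-· (g ⁻¹) g r)) (trans (cong (λ h → conj h r) (·-inverseˡ g)) (conj-e r))

  conj-injective : ∀ g {p q} → conj g p ≡ conj g q → p ≡ q
  conj-injective g eq = trans (sym (conj-cancel g _)) (trans (cong (conj (g ⁻¹)) eq) (conj-cancel g _))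

  conj-self : ∀ g → conj g g ≡ g
  conj-self g = conj-unique g g g refl

  word-++ : ∀ us vs → word (us ++ vs) ≡ word us · word vs
  word-++ []       vs = sym (·-identityˡ _)
  word-++ (i ∷ us) vs = trans (cong (gen i ·_) (word-++ us vs)) (sym (·-assoc _ _ _))

  -- Elementary properties of the length function.

  ℓ-e : ℓ e ≡ 0
  ℓ-e = n≤0⇒n≡0 (ℓ-minimal [])

  ℓ≡0⇒≡e : ℓ w ≡ 0 → w ≡ e
  ℓ≡0⇒≡e {w} eq with ℓ-attained w
  ... | []     , p , _ = sym p
  ... | _ ∷ _ , _ , q with () ← trans q eq

  ℓ-· : ∀ u v → ℓ (u · v) ≤ ℓ u + ℓ v
  ℓ-· u v with ℓ-attained u | ℓ-attained v
  ... | us , refl , p | vs , refl , q = subst₂ _≤_ (cong ℓ (word-++ us vs))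
        (trans (length-++ us) (cong₂ _+_ p q)) (ℓ-minimal (us ++ vs))

  ℓ-gen≤1 : ∀ i → ℓ (gen i) ≤ 1
  ℓ-gen≤1 i = subst (λ g → ℓ g ≤ 1) (·-identityʳ _) (ℓ-minimal (i ∷ []))

  ℓ-gen· : ∀ i w → ℓ (gen i · w) ≤ suc (ℓ w)
  ℓ-gen· i w = ≤-trans (ℓ-· _ _) (+-monoˡ-≤ (ℓ w) (ℓ-gen≤1 i))

  ℓ-·gen : ∀ w i → ℓ (w · gen i) ≤ suc (ℓ w)
  ℓ-·gen w i = ≤-trans (ℓ-· _ _) (≤-trans (+-monoʳ-≤ (ℓ w) (ℓ-gen≤1 i)) (≤-reflexive (+-comm (ℓ w) 1)))

  infix 4 _≟_
  abstract
    -- Only `e` has length 0, so the length of `u · v ⁻¹` decides equality.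
    _≟_ : (u v : W) → Dec (u ≡ v)
    u ≟ v = map′ (λ p → x∙y⁻¹≈ε⇒x≈y u v (ℓ≡0⇒≡e p)) (λ { refl → trans (cong ℓ (·-inverseʳ u)) ℓ-e })
                 (ℓ (u · v ⁻¹) ℕ.≟ 0)

  -- Dropping the first letter lowers the length by at most one, so every suffix of a reduced word
  -- is reduced and each letter put in front lengthens the element.
  left-induction : (P : W → Set) → P e → (∀ i w → ℓ w < ℓ (gen i · w) → P w → P (gen i · w)) →
                   ∀ w → P w
  left-induction P base step w with ℓ-attained w
  ... | ws , refl , q = go ws q
    where
    go : ∀ ws → length ws ≡ ℓ (word ws) → P (word ws)
    go []       q = base
    go (i ∷ ws) q = step i (word ws) (≤-trans (s≤s (ℓ-minimal ws)) (≤-reflexive q))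
      (go ws (≤-antisym (≤-pred (≤-trans (≤-reflexive q) (ℓ-gen· i (word ws)))) (ℓ-minimal ws)))

  anti-gen· : ∀ i w → (gen i · w) ⁻¹ ≡ w ⁻¹ · gen i
  anti-gen· i w = trans (⁻¹-anti-homo-∙ _ _) (cong (w ⁻¹ ·_) (gen⁻¹ i))

  anti-·gen : ∀ i w → (w · gen i) ⁻¹ ≡ gen i · w ⁻¹
  anti-·gen i w = trans (⁻¹-anti-homo-∙ _ _) (cong (_· w ⁻¹) (gen⁻¹ i))

  ℓ-⁻¹ : ∀ w → ℓ (w ⁻¹) ≡ ℓ w
  ℓ-⁻¹ w = ≤-antisym (bound w) (subst (λ v → ℓ v ≤ ℓ (w ⁻¹)) (⁻¹-involutive w) (bound (w ⁻¹)))
    where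
    bound : ∀ w → ℓ (w ⁻¹) ≤ ℓ w
    bound = left-induction _ (≤-reflexive (cong ℓ ε⁻¹≈ε)) λ i w lt ih →
      subst (λ v → ℓ v ≤ ℓ (gen i · w)) (sym (anti-gen· i w))
        (≤-trans (ℓ-·gen (w ⁻¹) i) (≤-trans (s≤s ih) lt))

  right-induction : (P : W → Set) → P e → (∀ w i → ℓ w < ℓ (w · gen i) → P w → P (w · gen i)) →
                    ∀ w → P w
  right-induction P base step w = subst P (⁻¹-involutive w)
    (left-induction (λ v → P (v ⁻¹)) (subst P (sym ε⁻¹≈ε) base)
      (λ i v lt p → subst P (sym (anti-gen· i v)) (step (v ⁻¹) i
        (subst₂ _<_ (sym (ℓ-⁻¹ v)) (trans (sym (ℓ-⁻¹ _)) (cong ℓ (anti-gen· i v))) lt) p))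
      (w ⁻¹))

  star-e : star e ≡ e
  star-e = identityˡ-unique _ _ (trans (sym (star-hom e e)) (cong star (·-identityˡ e)))

  ℓ-star : ∀ w → ℓ (star w) ≡ ℓ w
  ℓ-star w = ≤-antisym (bound w) (subst (λ v → ℓ v ≤ ℓ (star w)) (star-invol w) (bound (star w)))
    where
    bound : ∀ w → ℓ (star w) ≤ ℓ w
    bound = left-induction _ (≤-reflexive (cong ℓ star-e)) λ i w lt ih →
      let j , p = star-gen i in
      subst (λ v → ℓ v ≤ ℓ (gen i · w)) (sym (trans (star-hom _ _) (cong (_· star w) p)))
        (≤-trans (ℓ-gen· j (star w)) (≤-trans (s≤s ih) lt))

  -- The inversion cocycle and the deletion property.

  δ : W → W → Bool
  δ u v = does (u ≟ v)

  δ-refl : ∀ u → δ u u ≡ true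
  δ-refl u = dec-true (u ≟ u) refl

  δ-conj : ∀ g u v → δ (conj g u) (conj g v) ≡ δ u v
  δ-conj g u v = does-⇔ (mk⇔ (conj-injective g) (cong (conj g))) (conj g u ≟ conj g v) (u ≟ v)

  -- The semidirect product of (W → Bool) and W, with W acting by conjugation.  The
  -- homomorphism gen i ↦ (δ (gen i) , gen i) yields the inversion-set cocycle.
  signed : Group 0ℓ 0ℓ
  signed = record
    { Carrier = (W → Bool) × W
    ; _≈_ = λ (η , g) (θ , h) → (∀ r → η r ≡ θ r) × g ≡ h
    ; _∙_ = λ (η , g) (θ , h) → (λ r → η r xor θ (conj g r)) , g · h
    ; ε = (λ _ → false) , e
    ; _⁻¹ = λ (η , g) → (λ r → η (conj (g ⁻¹) r)) , g ⁻¹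
    ; isGroup = record
      { isMonoid = record
        { isSemigroup = record
          { isMagma = record
            { isEquivalence = record
              { refl = (λ _ → refl) , refl
              ; sym = λ (p , q) → (λ r → sym (p r)) , sym q
              ; trans = λ (p , q) (p′ , q′) → (λ r → trans (p r) (p′ r)) , trans q q′ }
            ; ∙-cong = λ { (p , refl) (p′ , refl) → (λ r → cong₂ _xor_ (p r) (p′ _)) , refl } }
          ; assoc = λ (η , g) (θ , h) (κ , k) →
              (λ r → trans (xor-assoc (η r) _ _)
                 (cong (λ q → η r xor (θ (conj g r) xor κ q)) (conj-· g h r)))
              , ·-assoc g h k }
        ; identity = (λ (η , g) → (λ r → cong η (conj-e r)) , ·-identityˡ g)
                   , (λ (η , g) → (λ r → xor-identityʳ (η r)) , ·-identityʳ g) }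
      ; inverse = (λ (η , g) → (λ r → xor-same (η (conj (g ⁻¹) r))) , ·-inverseˡ g)
                , (λ (η , g) → (λ r → trans (cong (λ q → η r xor η q) (conj-cancel g r)) (xor-same (η r)))
                             , ·-inverseʳ g)
      ; ⁻¹-cong = λ { (p , refl) → (λ r → p _) , refl } } }

  signed-gen : Fin n → Group.Carrier signed
  signed-gen i = δ (gen i) , gen i

  power : W → ℕ → W
  power = pow _·_ e

  power-+ : ∀ c k m → power c (k + m) ≡ power c k · power c m
  power-+ c zero    m = sym (·-identityˡ _)
  power-+ c (suc k) m = trans (cong (c ·_) (power-+ c k m)) (sym (·-assoc _ _ _))

  power-comm : ∀ c m → c · power c m ≡ power c m · c
  power-comm c zero    = trans (·-identityʳ c) (sym (·-identityˡ c))
  power-comm c (suc m) = trans (cong (c ·_) (power-comm c m)) (sym (·-assoc _ _ _))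

  module _ (i j : Fin n) where
    private
      s c : W
      s = gen i
      c = s · gen j

    -- The reflections met along the word (s t)^k are the elements c^m s with m < 2 k.
    dihedral : ℕ → W
    dihedral m = power c m · s

    scs : c · (s · c) ≡ s
    scs = begin
      c · (s · (s · gen j))   ≡⟨ cong (c ·_) (gen-cancelˡ i (gen j)) ⟩
      c · gen j               ≡⟨ gen-cancelʳ j s ⟩
      s                       ∎
      where open ≡-Reasoning

    -- Turns the conjugation by `c` in the semidirect product into a shift of the index by two.
    conj-dihedral : ∀ m → conj c (dihedral (2 + m)) ≡ dihedral m
    conj-dihedral m = conj-unique c _ _ (sym (begin
      (c · (c · p) · s) · c     ≡⟨ ·-assoc _ s c ⟩
      c · (c · p) · (s · c)     ≡⟨ ·-assoc c _ _ ⟩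
      c · ((c · p) · (s · c))   ≡⟨ cong (λ q → c · (q · (s · c))) (power-comm c m) ⟩
      c · ((p · c) · (s · c))   ≡⟨ cong (c ·_) (trans (·-assoc p c _) (cong (p ·_) scs)) ⟩
      c · (p · s)               ∎))
      where
      open ≡-Reasoning
      p = power c m

    conj-dihedral-1 : conj s (dihedral 1) ≡ gen j
    conj-dihedral-1 = conj-unique s _ _ (sym (begin
      (c · e · s) · s   ≡⟨ gen-cancelʳ i _ ⟩
      c · e             ≡⟨ ·-identityʳ c ⟩
      c                 ∎))
      where open ≡-Reasoning

    open Group signed using () renaming (_∙_ to _∙ˢ_; ε to εˢ)

    -- A further factor `c` contributes `dihedral 0` and `dihedral 1` and moves the earlier
    -- reflections up by two indices.
    signed-power : ∀ k → Group._≈_ signed (pow _∙ˢ_ εˢ (signed-gen i ∙ˢ signed-gen j) k)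
                           ((λ r → xorSum (λ m → δ (dihedral m) r) (k + k)) , power c k)
    signed-power zero    = (λ _ → refl) , refl
    signed-power (suc k) with signed-power k
    ... | ih , refl′ = (λ r → begin
        (δ s r xor δ (gen j) (conj s r)) xor proj₁ (pow _∙ˢ_ εˢ _ k) (conj c r)
          ≡⟨ cong₂ _xor_ (cong₂ _xor_ (cong (λ q → δ q r) (sym (·-identityˡ s)))
               (trans (cong (λ q → δ q (conj s r)) (sym conj-dihedral-1)) (δ-conj s _ r)))
               (trans (ih (conj c r)) (xorSum-cong (λ m →
                  trans (cong (λ q → δ q (conj c r)) (sym (conj-dihedral m))) (δ-conj c _ r)) (k + k))) ⟩
        (δ (dihedral 0) r xor δ (dihedral 1) r) xor xorSum (λ m → δ (dihedral (2 + m)) r) (k + k)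
          ≡⟨ xor-assoc (δ (dihedral 0) r) _ _ ⟩
        xorSum (λ m → δ (dihedral m) r) (2 + (k + k))
          ≡⟨ cong (xorSum (λ m → δ (dihedral m) r)) (cong suc (sym (+-suc k k))) ⟩
        xorSum (λ m → δ (dihedral m) r) (suc k + suc k) ∎)
      , cong (c ·_) refl′
      where open ≡-Reasoning

    -- If `c` to the power `k` is trivial, the sequence of `k + k` reflections consists of two equal
    -- periods, which cancel modulo 2.
    signed-relation : ∀ k → power c k ≡ e →
      Group._≈_ signed (pow _∙ˢ_ εˢ (signed-gen i ∙ˢ signed-gen j) k) εˢ
    signed-relation k ck≡e = let p , q = signed-power k in
      (λ r → trans (p r) (xorSum-periodic _ k λ m →
        cong (λ q → δ (q · s) r) (trans (power-+ c k m) (trans (cong (_· power c m) ck≡e) (·-identityˡ _)))))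
      , trans q ck≡e

  private
    signed-hom = presentation signed signed-gen signed-relation
    φ = proj₁ signed-hom
    φ-· = proj₁ (proj₂ signed-hom)
    φ-gen = proj₂ (proj₂ signed-hom)

    φ-e : Group._≈_ signed (φ e) (Group.ε signed)
    φ-e = GroupProperties.identityˡ-unique signed (φ e) (φ e)
      (Group.trans signed (Group.sym signed (φ-· e e)) (Group.reflexive signed (cong φ (·-identityˡ e))))

    φ₂ : ∀ w → proj₂ (φ w) ≡ w
    φ₂ = left-induction _ (proj₂ φ-e) λ i w _ ih →
      trans (proj₂ (φ-· (gen i) w)) (cong₂ _·_ (proj₂ (φ-gen i)) ih)

  abstract
    -- On reflections, the indicator of the left inversions of `w`, those `t` with
    -- `ℓ (t · w) < ℓ w`; see `N-true⇒ℓ>` and `N-false⇒ℓ<`.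
    N : W → W → Bool
    N w = proj₁ (φ w)

    N-· : ∀ u v r → N (u · v) r ≡ N u r xor N v (conj u r)
    N-· u v r = trans (proj₁ (φ-· u v) r) (cong (λ q → N u r xor N v (conj q r)) (φ₂ u))

    N-e : ∀ r → N e r ≡ false
    N-e = proj₁ φ-e

    N-gen : ∀ i r → N (gen i) r ≡ δ (gen i) r
    N-gen i = proj₁ (φ-gen i)

  -- Either `t` is the first letter, which is dropped, or the cocycle law passes the inversion on to
  -- the tail, with `t` conjugated past the first letter.
  deletion : ∀ ws t → N (word ws) t ≡ true →
             ∃ λ ws′ → length ws′ < length ws × word ws′ ≡ t · word ws
  deletion [] t p with () ← trans (sym (N-e t)) p
  deletion (i ∷ ws) t p with gen i ≟ t
  ... | yes refl = ws , ≤-refl , sym (gen-cancelˡ i (word ws))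
  ... | no  ≢t with deletion ws (conj (gen i) t)
        (trans (cong (_xor N (word ws) (conj (gen i) t)) (sym (trans (N-gen i t) (dec-false (gen i ≟ t) ≢t))))
               (trans (sym (N-· (gen i) (word ws) t)) p))
  ... | ws′ , lt , q = i ∷ ws′ , s≤s lt , (begin
          gen i · word ws′                        ≡⟨ cong (gen i ·_) q ⟩
          gen i · (conj (gen i) t · word ws)      ≡⟨ ·-assoc _ _ _ ⟨
          (gen i · conj (gen i) t) · word ws      ≡⟨ cong (_· word ws) (·-conj (gen i) t) ⟩
          (t · gen i) · word ws                   ≡⟨ ·-assoc _ _ _ ⟩
          t · (gen i · word ws)                   ∎)
          where open ≡-Reasoning

  N-true⇒ℓ> : ∀ {t w} → N w t ≡ true → ℓ (t · w) < ℓ w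
  N-true⇒ℓ> {t} {w} p with ℓ-attained w
  ... | ws , refl , q with deletion ws t p
  ... | ws′ , lt , r = ≤-trans (s≤s (subst (λ v → ℓ v ≤ length ws′) r (ℓ-minimal ws′)))
                               (≤-trans lt (≤-reflexive q))

  -- Reflections and strong exchange.

  conj-reflection : IsReflection t → ∃ λ g → ∃ λ i → conj g t ≡ gen i
  conj-reflection {t} (g , i , refl) = g , i , conj-unique g _ _ (sym (//-rightDividesˡ g (g · gen i)))

  reflection : ∀ g i t → conj g t ≡ gen i → IsReflection t
  reflection g i t eq = g , i ,
    trans (sym (//-rightDividesʳ g t)) (cong (_· g ⁻¹) (trans (sym (·-conj g t)) (cong (g ·_) eq)))

  gen-reflection : ∀ i → IsReflection (gen i)
  gen-reflection i = reflection e i _ (conj-e _)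

  IsReflection-conj : ∀ u → IsReflection t → IsReflection (conj u t)
  IsReflection-conj {t} u r = let g , i , eq = conj-reflection r in
    reflection (u ⁻¹ · g) i _ (trans (conj-· (u ⁻¹) g _) (trans (cong (conj g) (conj-cancel u t)) eq))

  reflection-involution : IsReflection t → t · t ≡ e
  reflection-involution {t} r = let g , i , eq = conj-reflection r in
    conj-injective g (begin
      conj g (t · t)         ≡⟨ conj-unique g _ _ (begin
                                   g · (conj g t · conj g t)   ≡⟨ ·-assoc _ _ _ ⟨
                                   (g · conj g t) · conj g t   ≡⟨ cong (_· conj g t) (·-conj g t) ⟩
                                   (t · g) · conj g t          ≡⟨ ·-assoc _ _ _ ⟩
                                   t · (g · conj g t)          ≡⟨ cong (t ·_) (·-conj g t) ⟩
                                   t · (t · g)                 ≡⟨ ·-assoc _ _ _ ⟨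
                                   (t · t) · g                 ∎) ⟩
      conj g t · conj g t    ≡⟨ cong₂ _·_ eq eq ⟩
      gen i · gen i          ≡⟨ gen-involution i ⟩
      e                      ≡⟨ conj-unique g e e (trans (·-identityʳ g) (sym (·-identityˡ g))) ⟨
      conj g e               ∎)
    where open ≡-Reasoning

  -- With `t` written as a conjugate of a generator by `g`, the contributions of `g` and `g ⁻¹`
  -- agree because `N (g · g ⁻¹)` vanishes. Only that of the generator in the middle remains.
  N-reflection : IsReflection t → N t t ≡ true
  N-reflection {t} r = let g , i , eq = conj-reflection r in begin
      N t t
        ≡⟨ cong (λ q → N q t) (trans (sym (//-rightDividesʳ g t))
             (cong (_· g ⁻¹) (trans (sym (·-conj g t)) (cong (g ·_) eq)))) ⟩
      N ((g · gen i) · g ⁻¹) t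
        ≡⟨ cong (λ q → N q t) (·-assoc _ _ _) ⟩
      N (g · (gen i · g ⁻¹)) t
        ≡⟨ N-· g _ t ⟩
      N g t xor N (gen i · g ⁻¹) (conj g t)
        ≡⟨ cong (λ q → N g t xor N (gen i · g ⁻¹) q) eq ⟩
      N g t xor N (gen i · g ⁻¹) (gen i)
        ≡⟨ cong (N g t xor_) (trans (N-· (gen i) _ _) (cong₂ _xor_
             (trans (N-gen i _) (δ-refl _)) (cong (N (g ⁻¹)) (conj-self (gen i))))) ⟩
      N g t xor (true xor N (g ⁻¹) (gen i))
        ≡⟨ not-right (N g t) _ (begin
             N g t xor N (g ⁻¹) (gen i)    ≡⟨ cong (λ q → N g t xor N (g ⁻¹) q) eq ⟨
             N g t xor N (g ⁻¹) (conj g t) ≡⟨ N-· g (g ⁻¹) t ⟨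
             N (g · g ⁻¹) t                ≡⟨ cong (λ q → N q t) (·-inverseʳ g) ⟩
             N e t                         ≡⟨ N-e t ⟩
             false                         ∎) ⟩
      true ∎
    where
    open ≡-Reasoning
    not-right : ∀ p q → p xor q ≡ false → p xor (true xor q) ≡ true
    not-right false false _ = refl
    not-right true  true  _ = refl

  -- Multiplication by `t` flips the value at `t`, so `t` is an inversion of `t · w`, and deleting
  -- it returns to `w`.
  N-false⇒ℓ< : ∀ {t w} → IsReflection t → N w t ≡ false → ℓ w < ℓ (t · w)
  N-false⇒ℓ< {t} {w} r p = subst (λ v → ℓ v < ℓ (t · w))
    (trans (sym (·-assoc t t w)) (trans (cong (_· w) (reflection-involution r)) (·-identityˡ w)))
    (N-true⇒ℓ> (trans (N-· t w t) (cong₂ _xor_ (N-reflection r) (trans (cong (N w) (conj-self t)) p))))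

  -- Bruhat steps and multiplication by simple generators.

  step-intro : IsReflection t → ℓ u < ℓ (t · u) → BruhatStep u (t · u)
  step-intro {t} {u} r lt = conj u t , IsReflection-conj u r , sym (·-conj u t) , lt

  -- Conjugation by `u` moves the reflection to the left, where the length condition becomes a value
  -- of the cocycle.
  step-elim : BruhatStep u v → ∃ λ t → IsReflection t × v ≡ t · u × N u t ≡ false
  step-elim {u} (t , r , refl , lt) = t′ , IsReflection-conj (u ⁻¹) r , eq , N-false
    where
    t′ = conj (u ⁻¹) t
    eq : u · t ≡ t′ · u
    eq = trans (cong (u ·_) (sym (conj-cancel′ u t))) (·-conj u t′)
    N-false : N u t′ ≡ false
    N-false with N u t′ in p
    ... | false = refl
    ... | true  = ⊥-elim (<-asym lt (subst (λ v → ℓ v < ℓ u) (sym eq) (N-true⇒ℓ> p)))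

  abstract
    reflection-comparable : IsReflection t → ∀ u → BruhatStep u (t · u) ⊎ BruhatStep (t · u) u
    reflection-comparable {t} r u with N u t in p
    ... | false = inj₁ (step-intro r (N-false⇒ℓ< r p))
    ... | true  = inj₂ (subst (BruhatStep (t · u)) ttu
                    (step-intro r (subst (λ v → ℓ (t · u) < ℓ v) (sym ttu) (N-true⇒ℓ> p))))
      where
      ttu : t · (t · u) ≡ u
      ttu = trans (sym (·-assoc t t u)) (trans (cong (_· u) (reflection-involution r)) (·-identityˡ u))

  step-irrefl : BruhatStep u v → ¬ BruhatStep v u
  step-irrefl (_ , _ , _ , lt) (_ , _ , _ , gt) = <-asym lt gt

  ≤B⇒ℓ≤ : u ≤B v → ℓ u ≤ ℓ v
  ≤B⇒ℓ≤ done = ≤-refl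
  ≤B⇒ℓ≤ ((_ , _ , _ , lt) ◅ ss) = ≤-trans (<⇒≤ lt) (≤B⇒ℓ≤ ss)

  step⇒≤B : BruhatStep u v → u ≤B v
  step⇒≤B s = s ◅ done

  ≡⇒≤B : u ≡ v → u ≤B v
  ≡⇒≤B refl = done

  ≤B-e : u ≤B e → u ≡ e
  ≤B-e {u} u≤e = ℓ≡0⇒≡e (n≤0⇒n≡0 (≤-trans (≤B⇒ℓ≤ u≤e) (≤-reflexive ℓ-e)))

  -- Multiplication by a simple generator on either side; `step` is the only way in which
  -- the strong exchange property enters the study of the Bruhat order.
  record Mirror : Set where
    field
      m          : W → W
      involutive : ∀ u → m (m u) ≡ u
      comparable : ∀ u → BruhatStep u (m u) ⊎ BruhatStep (m u) u
      step       : BruhatStep u v → m u ≡ v ⊎ BruhatStep (m u) (m v)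

    abstract
      -- The larger and the smaller of `u` and `m u`.
      up down : W → W
      up   u = [ (λ _ → m u) , (λ _ → u) ]′ (comparable u)
      down u = [ (λ _ → u) , (λ _ → m u) ]′ (comparable u)

      up-asc : BruhatStep u (m u) → up u ≡ m u
      up-asc {u} s with comparable u
      ... | inj₁ _  = refl
      ... | inj₂ s′ = ⊥-elim (step-irrefl s s′)

      up-desc : BruhatStep (m u) u → up u ≡ u
      up-desc {u} s with comparable u
      ... | inj₁ s′ = ⊥-elim (step-irrefl s s′)
      ... | inj₂ _  = refl

      down-asc : BruhatStep u (m u) → down u ≡ u
      down-asc {u} s with comparable u
      ... | inj₁ _  = refl
      ... | inj₂ s′ = ⊥-elim (step-irrefl s s′)

      down-desc : BruhatStep (m u) u → down u ≡ m u
      down-desc {u} s with comparable u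
      ... | inj₁ s′ = ⊥-elim (step-irrefl s s′)
      ... | inj₂ _  = refl

      asc⇒desc : BruhatStep u (m u) → BruhatStep (m (m u)) (m u)
      asc⇒desc {u} = subst (λ v → BruhatStep v (m u)) (sym (involutive u))

      desc⇒asc : BruhatStep (m u) u → BruhatStep (m u) (m (m u))
      desc⇒asc {u} = subst (BruhatStep (m u)) (sym (involutive u))

      up-m : ∀ u → up (m u) ≡ up u
      up-m u with comparable u
      ... | inj₁ s = up-desc (asc⇒desc s)
      ... | inj₂ s = trans (up-asc (desc⇒asc s)) (involutive u)

      down-m : ∀ u → down (m u) ≡ down u
      down-m u with comparable u
      ... | inj₁ s = trans (down-desc (asc⇒desc s)) (involutive u)
      ... | inj₂ s = down-asc (desc⇒asc s)

      ≤up : ∀ u → u ≤B up u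
      ≤up u with comparable u
      ... | inj₁ s = step⇒≤B s
      ... | inj₂ _ = done

      m≤up : ∀ u → m u ≤B up u
      m≤up u = subst (m u ≤B_) (up-m u) (≤up (m u))

      down≤ : ∀ u → down u ≤B u
      down≤ u with comparable u
      ... | inj₁ _ = done
      ... | inj₂ s = step⇒≤B s

      down≤m : ∀ u → down u ≤B m u
      down≤m u = subst (_≤B m u) (down-m u) (down≤ (m u))

      -- A single step suffices. If it joins `u` to `m u`, both ends have the same `up`; otherwise
      -- `m u` lies below `m v`, so either choice for `up u` lies below `up v`.
      up-mono : u ≤B v → up u ≤B up v
      up-mono = kleisliStar up up-step
        where
        up-step : BruhatStep u v → up u ≤B up v
        up-step {u} {v} s with step s
        ... | inj₁ refl = ≡⇒≤B (sym (up-m u))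
        ... | inj₂ s′ with comparable u
        ...   | inj₁ _ = step⇒≤B s′ ◅◅ m≤up v
        ...   | inj₂ _ = step⇒≤B s ◅◅ ≤up v

      down-mono : u ≤B v → down u ≤B down v
      down-mono = kleisliStar down down-step
        where
        down-step : BruhatStep u v → down u ≤B down v
        down-step {u} {v} s with step s
        ... | inj₁ refl = ≡⇒≤B (sym (down-m u))
        ... | inj₂ s′ with comparable v
        ...   | inj₁ _ = down≤ u ◅◅ step⇒≤B s
        ...   | inj₂ _ = down≤m u ◅◅ step⇒≤B s′

      up-fixed⇒desc : up u ≡ u → BruhatStep (m u) u
      up-fixed⇒desc {u} eq with comparable u
      ... | inj₁ (_ , _ , _ , lt) = ⊥-elim (<-irrefl (cong ℓ (sym eq)) lt)
      ... | inj₂ s = s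

  -- The exceptional case of `step` is the one reflection that the generator itself realizes at `u`.
  -- At every other reflection the generator contributes nothing to the cocycle, so the step keeps
  -- its direction.
  left right : Fin n → Mirror
  left i = record
    { m = gen i ·_
    ; involutive = gen-cancelˡ i
    ; comparable = reflection-comparable (gen-reflection i)
    ; step = step }
    where
    step : BruhatStep u v → gen i · u ≡ v ⊎ BruhatStep (gen i · u) (gen i · v)
    step {u} s with step-elim s
    ... | t , r , refl , p with gen i ≟ t
    ...   | yes refl = inj₁ refl
    ...   | no  g≢t  = inj₂ (subst (BruhatStep (gen i · u)) eq (step-intro r′ (N-false⇒ℓ< r′ N-false)))
      where
      t′ = conj (gen i ⁻¹) t
      r′ = IsReflection-conj (gen i ⁻¹) r
      back : conj (gen i) t′ ≡ t
      back = conj-cancel′ (gen i) t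
      eq : t′ · (gen i · u) ≡ gen i · (t · u)
      eq = begin
        t′ · (gen i · u)              ≡⟨ ·-assoc _ _ _ ⟨
        (t′ · gen i) · u              ≡⟨ cong (_· u) (·-conj (gen i) t′) ⟨
        (gen i · conj (gen i) t′) · u ≡⟨ ·-assoc _ _ _ ⟩
        gen i · (conj (gen i) t′ · u) ≡⟨ cong (λ q → gen i · (q · u)) back ⟩
        gen i · (t · u)               ∎
        where open ≡-Reasoning
      N-false : N (gen i · u) t′ ≡ false
      N-false = trans (N-· (gen i) u t′) (cong₂ _xor_
        (trans (N-gen i t′) (dec-false (gen i ≟ t′)
          (λ { eq′ → g≢t (trans (sym (conj-self (gen i))) (trans (cong (conj (gen i)) eq′) back)) })))
        (trans (cong (N u) back) p))
  right i = record
    { m = _· gen i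
    ; involutive = gen-cancelʳ i
    ; comparable = λ u → subst (λ v → BruhatStep u v ⊎ BruhatStep v u) (flip-side u)
        (reflection-comparable (IsReflection-conj (u ⁻¹) (gen-reflection i)) u)
    ; step = step }
    where
    flip-side : ∀ u → conj (u ⁻¹) (gen i) · u ≡ u · gen i
    flip-side u = trans (sym (·-conj u _)) (cong (u ·_) (conj-cancel′ u (gen i)))
    step : BruhatStep u v → u · gen i ≡ v ⊎ BruhatStep (u · gen i) (v · gen i)
    step {u} s with step-elim s
    ... | t , r , refl , p with gen i ≟ conj u t
    ...   | yes eq  = inj₁ (trans (cong (u ·_) eq) (·-conj u t))
    ...   | no  g≢t = inj₂ (subst (BruhatStep (u · gen i)) (sym (·-assoc t u (gen i)))
              (step-intro r (N-false⇒ℓ< r (trans (N-· u (gen i) t) (cong₂ _xor_ p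
                (trans (N-gen i _) (dec-false (gen i ≟ conj u t) g≢t)))))))

-- Ascents and descents of twisted involutions.

module TwistedInvolutions (C : TwistedCoxeterSystem) (D : DemazureProduct C) where
  open TwistedCoxeterSystem C
  open DemazureProduct D
  open Twisted C D
  open Coxeter C

  private
    variable
      v x y : W
      i : Fin n

  _* : Fin n → Fin n
  i * = proj₁ (star-gen i)

  star-gen* : ∀ i → star (gen (i *)) ≡ gen i
  star-gen* i = trans (cong star (sym (proj₂ (star-gen i)))) (star-invol (gen i))

  module Left (i : Fin n) = Mirror (left i)
  module Lᵐ (i : Fin n) = Mirror (left (i *))
  module Rᵐ (i : Fin n) = Mirror (right i)

  step⇒ℓ< : BruhatStep x y → ℓ x < ℓ y
  step⇒ℓ< (_ , _ , _ , lt) = lt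

  gen∘ : ∀ i w → gen i ∘ w ≡ Left.up i w
  gen∘ i w with Left.comparable i w
  ... | inj₁ s = trans (∘-left-up i w (step⇒ℓ< s)) (sym (Left.up-asc i s))
  ... | inj₂ s = trans (∘-left-down i w (<-asym (step⇒ℓ< s))) (sym (Left.up-desc i s))

  ∘gen : ∀ i w → w ∘ gen i ≡ Rᵐ.up i w
  ∘gen i w with Rᵐ.comparable i w
  ... | inj₁ s = trans (∘-right-up i w (step⇒ℓ< s)) (sym (Rᵐ.up-asc i s))
  ... | inj₂ s = trans (∘-right-down i w (<-asym (step⇒ℓ< s))) (sym (Rᵐ.up-desc i s))

  ℓ-up : ∀ i w → ℓ (Rᵐ.up i w) ≤ suc (ℓ w)
  ℓ-up i w with Rᵐ.comparable i w
  ... | inj₁ s = subst (λ v → ℓ v ≤ suc (ℓ w)) (sym (Rᵐ.up-asc i s)) (ℓ-·gen w i)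
  ... | inj₂ s = subst (λ v → ℓ v ≤ suc (ℓ w)) (sym (Rᵐ.up-desc i s)) (n≤1+n (ℓ w))

  Asc Desc : Fin n → W → Set
  Asc  i x = BruhatStep x (x · gen i)
  Desc i x = BruhatStep (x · gen i) x

  -- Inversion followed by `star` exchanges the two sides of a twisted involution, so `gen (i *)` on
  -- the left behaves like `gen i` on the right.
  Inv-· : Inv x → (x · gen i) ⁻¹ ≡ star (gen (i *) · x)
  Inv-· {x} {i} inv = begin
    (x · gen i) ⁻¹             ≡⟨ anti-·gen i x ⟩
    gen i · x ⁻¹               ≡⟨ cong₂ _·_ (sym (star-gen* i)) inv ⟩
    star (gen (i *)) · star x  ≡⟨ star-hom _ _ ⟨
    star (gen (i *) · x)       ∎
    where open ≡-Reasoning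

  Inv-Lm≡Rm : Inv x → gen (i *) · x ≡ x · gen i → Inv (x · gen i)
  Inv-Lm≡Rm inv eq = trans (Inv-· inv) (cong star eq)

  Inv-LmRm : Inv x → Inv (gen (i *) · (x · gen i))
  Inv-LmRm {x} {i} inv = begin
    (gen (i *) · (x · gen i)) ⁻¹        ≡⟨ anti-gen· (i *) _ ⟩
    (x · gen i) ⁻¹ · gen (i *)          ≡⟨ cong₂ _·_ (Inv-· inv) (sym (proj₂ (star-gen i))) ⟩
    star (gen (i *) · x) · star (gen i) ≡⟨ star-hom _ _ ⟨
    star ((gen (i *) · x) · gen i)      ≡⟨ cong star (·-assoc _ _ _) ⟩
    star (gen (i *) · (x · gen i))      ∎
    where open ≡-Reasoning

  ℓ-Lm≡ℓ-Rm : Inv x → ℓ (gen (i *) · x) ≡ ℓ (x · gen i)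
  ℓ-Lm≡ℓ-Rm {x} {i} inv = trans (sym (ℓ-star _)) (trans (cong ℓ (sym (Inv-· inv))) (ℓ-⁻¹ (x · gen i)))

  Asc-left : Inv x → Asc i x → BruhatStep x (gen (i *) · x)
  Asc-left {x} {i} inv s with Lᵐ.comparable i x
  ... | inj₁ s′ = s′
  ... | inj₂ s′ = ⊥-elim (<-asym (step⇒ℓ< s) (subst (_< ℓ x) (ℓ-Lm≡ℓ-Rm inv) (step⇒ℓ< s′)))

  Desc-left : Inv x → Desc i x → BruhatStep (gen (i *) · x) x
  Desc-left {x} {i} inv s with Lᵐ.comparable i x
  ... | inj₁ s′ = ⊥-elim (<-asym (step⇒ℓ< s) (subst (ℓ x <_) (ℓ-Lm≡ℓ-Rm inv) (step⇒ℓ< s′)))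
  ... | inj₂ s′ = s′

  -- `raise i x` is the Demazure conjugate of `x` by `gen i`, and `lower` is its downward
  -- counterpart. Unlike the twisted action itself, both are composites of monotone maps.
  raise lower : Fin n → W → W
  raise i x = Lᵐ.up i (Rᵐ.up i x)
  lower i x = Lᵐ.down i (Rᵐ.down i x)

  lower-mono : ∀ i → x ≤B y → lower i x ≤B lower i y
  lower-mono i x≤y = Lᵐ.down-mono i (Rᵐ.down-mono i x≤y)

  raise-desc : Inv x → Desc i x → raise i x ≡ x
  raise-desc {i = i} inv s = trans (cong (Lᵐ.up i) (Rᵐ.up-desc i s)) (Lᵐ.up-desc i (Desc-left inv s))

  lower-asc : Inv x → Asc i x → lower i x ≡ x
  lower-asc {i = i} inv s = trans (cong (Lᵐ.down i) (Rᵐ.down-asc i s)) (Lᵐ.down-asc i (Asc-left inv s))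

  record Raised (i : Fin n) (x : W) : Set where
    field
      act         : IsTwistedAct x i (raise i x)
      inv         : Inv (raise i x)
      lower-raise : lower i (raise i x) ≡ x

  -- If `gen (i *) · x ≡ x · gen i`, the second multiplication is absorbed. Otherwise the
  -- exceptional case of `Mirror.step` is excluded, so the ascent on one side survives
  -- multiplication on the other and both multiplications lengthen.
  asc-raised : Inv x → Asc i x → Raised i x
  asc-raised {x} {i} inv s with gen (i *) · x ≟ x · gen i
  ... | yes eq = record
    { act = inj₂ (trans (cong (_· x) (proj₂ (star-gen i))) eq , raise≡)
    ; inv = subst Inv (sym raise≡) (Inv-Lm≡Rm inv eq)
    ; lower-raise = trans (cong (lower i) raise≡)
        (trans (cong (Lᵐ.down i) (Rᵐ.down-m i x)) (lower-asc inv s)) }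
    where
    raise≡ : raise i x ≡ x · gen i
    raise≡ = begin
      Lᵐ.up i (Rᵐ.up i x)      ≡⟨ cong (Lᵐ.up i) (Rᵐ.up-asc i s) ⟩
      Lᵐ.up i (x · gen i)      ≡⟨ cong (Lᵐ.up i) eq ⟨
      Lᵐ.up i (gen (i *) · x)  ≡⟨ Lᵐ.up-m i x ⟩
      Lᵐ.up i x                ≡⟨ Lᵐ.up-asc i (Asc-left inv s) ⟩
      gen (i *) · x            ≡⟨ eq ⟩
      x · gen i                ∎
      where open ≡-Reasoning
  ... | no neq = record
    { act = inj₁ ((λ eq → neq (trans (cong (_· x) (sym (proj₂ (star-gen i)))) eq))
                 , trans raise≡ (trans (sym (·-assoc _ _ _))
                     (cong (λ g → (g · x) · gen i) (sym (proj₂ (star-gen i))))))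
    ; inv = subst Inv (sym raise≡) (Inv-LmRm inv)
    ; lower-raise = begin
        lower i (raise i x)
          ≡⟨ cong (lower i) (trans raise≡ (sym (·-assoc _ _ _))) ⟩
        Lᵐ.down i (Rᵐ.down i ((gen (i *) · x) · gen i))
          ≡⟨ cong (Lᵐ.down i) (trans (Rᵐ.down-m i _) (Rᵐ.down-asc i Lx-asc)) ⟩
        Lᵐ.down i (gen (i *) · x)
          ≡⟨ trans (Lᵐ.down-m i x) (Lᵐ.down-asc i (Asc-left inv s)) ⟩
        x ∎ }
    where
    open ≡-Reasoning
    Rx-asc : BruhatStep (x · gen i) (gen (i *) · (x · gen i))
    Rx-asc with Rᵐ.step i (Asc-left inv s)
    ... | inj₁ eq = ⊥-elim (neq (sym eq))
    ... | inj₂ s′ = subst (BruhatStep (x · gen i)) (·-assoc _ _ _) s′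
    Lx-asc : Asc i (gen (i *) · x)
    Lx-asc with Lᵐ.step i s
    ... | inj₁ eq = ⊥-elim (neq eq)
    ... | inj₂ s′ = subst (BruhatStep (gen (i *) · x)) (sym (·-assoc _ _ _)) s′
    raise≡ : raise i x ≡ gen (i *) · (x · gen i)
    raise≡ = trans (cong (Lᵐ.up i) (Rᵐ.up-asc i s)) (Lᵐ.up-asc i Rx-asc)

  record Lowered (i : Fin n) (x : W) : Set where
    field
      act         : IsTwistedAct x i (lower i x)
      inv         : Inv (lower i x)
      raise-lower : raise i (lower i x) ≡ x

  -- The case distinction of `asc-raised` with all steps reversed.
  desc-lowered : Inv x → Desc i x → Lowered i x
  desc-lowered {x} {i} inv s with gen (i *) · x ≟ x · gen i
  ... | yes eq = record
    { act = inj₂ (trans (cong (_· x) (proj₂ (star-gen i))) eq , lower≡)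
    ; inv = subst Inv (sym lower≡) (Inv-Lm≡Rm inv eq)
    ; raise-lower = trans (cong (raise i) lower≡)
        (trans (cong (Lᵐ.up i) (Rᵐ.up-m i x)) (raise-desc inv s)) }
    where
    lower≡ : lower i x ≡ x · gen i
    lower≡ = begin
      Lᵐ.down i (Rᵐ.down i x)    ≡⟨ cong (Lᵐ.down i) (Rᵐ.down-desc i s) ⟩
      Lᵐ.down i (x · gen i)      ≡⟨ cong (Lᵐ.down i) eq ⟨
      Lᵐ.down i (gen (i *) · x)  ≡⟨ Lᵐ.down-m i x ⟩
      Lᵐ.down i x                ≡⟨ Lᵐ.down-desc i (Desc-left inv s) ⟩
      gen (i *) · x              ≡⟨ eq ⟩
      x · gen i                  ∎
      where open ≡-Reasoning
  ... | no neq = record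
    { act = inj₁ ((λ eq → neq (trans (cong (_· x) (sym (proj₂ (star-gen i)))) eq))
                 , trans lower≡ (trans (sym (·-assoc _ _ _))
                     (cong (λ g → (g · x) · gen i) (sym (proj₂ (star-gen i))))))
    ; inv = subst Inv (sym lower≡) (Inv-LmRm inv)
    ; raise-lower = begin
        raise i (lower i x)
          ≡⟨ cong (raise i) (trans lower≡ (sym (·-assoc _ _ _))) ⟩
        Lᵐ.up i (Rᵐ.up i ((gen (i *) · x) · gen i))
          ≡⟨ cong (Lᵐ.up i) (trans (Rᵐ.up-m i _) (Rᵐ.up-desc i Lx-desc)) ⟩
        Lᵐ.up i (gen (i *) · x)
          ≡⟨ trans (Lᵐ.up-m i x) (Lᵐ.up-desc i (Desc-left inv s)) ⟩
        x ∎ }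
    where
    open ≡-Reasoning
    Rx-desc : BruhatStep (gen (i *) · (x · gen i)) (x · gen i)
    Rx-desc with Rᵐ.step i (Desc-left inv s)
    ... | inj₁ eq = ⊥-elim (neq (begin
            gen (i *) · x                  ≡⟨ gen-cancelʳ i _ ⟨
            ((gen (i *) · x) · gen i) · gen i ≡⟨ cong (_· gen i) eq ⟩
            x · gen i                      ∎))
    ... | inj₂ s′ = subst (λ v → BruhatStep v (x · gen i)) (·-assoc _ _ _) s′
    Lx-desc : Desc i (gen (i *) · x)
    Lx-desc with Lᵐ.step i s
    ... | inj₁ eq = ⊥-elim (neq (begin
            gen (i *) · x                         ≡⟨ cong (gen (i *) ·_) eq ⟨
            gen (i *) · (gen (i *) · (x · gen i)) ≡⟨ gen-cancelˡ (i *) _ ⟩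
            x · gen i                             ∎))
    ... | inj₂ s′ = subst (λ v → BruhatStep v (gen (i *) · x)) (sym (·-assoc _ _ _)) s′
    lower≡ : lower i x ≡ gen (i *) · (x · gen i)
    lower≡ = trans (cong (Lᵐ.down i) (Rᵐ.down-desc i s)) (Lᵐ.down-desc i Rx-desc)

  IsTwistedAct-unique : IsTwistedAct x i y → IsTwistedAct x i v → y ≡ v
  IsTwistedAct-unique (inj₁ (_ , p))  (inj₁ (_ , q))  = trans p (sym q)
  IsTwistedAct-unique (inj₁ (ne , _)) (inj₂ (eq , _)) = ⊥-elim (ne eq)
  IsTwistedAct-unique (inj₂ (eq , _)) (inj₁ (ne , _)) = ⊥-elim (ne eq)
  IsTwistedAct-unique (inj₂ (_ , p))  (inj₂ (_ , q))  = trans p (sym q)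

  lower≤ : ∀ i x → lower i x ≤B x
  lower≤ i x = Lᵐ.down≤ i _ ◅◅ Rᵐ.down≤ i x

  Inv-raise : ∀ i → Inv x → Inv (raise i x)
  Inv-raise {x} i inv with Rᵐ.comparable i x
  ... | inj₁ s = Raised.inv (asc-raised inv s)
  ... | inj₂ s = subst Inv (sym (raise-desc inv s)) inv

  -- The Demazure product with neutral element `e`, and its twisted action.

  module Identity (idem : e ∘ e ≡ e) where

    -- The axioms prescribe only products with generators; associativity carries `idem` along a
    -- reduced word.
    ∘-identityˡ : ∀ w → e ∘ w ≡ w
    ∘-identityˡ = right-induction _ idem λ w i lt ih → begin
      e ∘ (w · gen i)   ≡⟨ cong (e ∘_) (∘-right-up i w lt) ⟨
      e ∘ (w ∘ gen i)   ≡⟨ ∘-assoc _ _ _ ⟨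
      (e ∘ w) ∘ gen i   ≡⟨ cong (_∘ gen i) ih ⟩
      w ∘ gen i         ≡⟨ ∘-right-up i w lt ⟩
      w · gen i         ∎
      where open ≡-Reasoning

    ∘-identityʳ : ∀ w → w ∘ e ≡ w
    ∘-identityʳ = left-induction _ idem λ i w lt ih → begin
      (gen i · w) ∘ e   ≡⟨ cong (_∘ e) (∘-left-up i w lt) ⟨
      (gen i ∘ w) ∘ e   ≡⟨ ∘-assoc _ _ _ ⟩
      gen i ∘ (w ∘ e)   ≡⟨ cong (gen i ∘_) ih ⟩
      gen i ∘ w         ≡⟨ ∘-left-up i w lt ⟩
      gen i · w         ∎
      where open ≡-Reasoning

    gen·∘ : ∀ i c x → ℓ c < ℓ (gen i · c) → (gen i · c) ∘ x ≡ Left.up i (c ∘ x)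
    gen·∘ i c x lt = begin
      (gen i · c) ∘ x       ≡⟨ cong (_∘ x) (∘-left-up i c lt) ⟨
      (gen i ∘ c) ∘ x       ≡⟨ ∘-assoc _ _ _ ⟩
      gen i ∘ (c ∘ x)       ≡⟨ gen∘ i _ ⟩
      Left.up i (c ∘ x)     ∎
      where open ≡-Reasoning

    -- The letters of a reduced word of `c` act by the monotone maps `Left.up`.
    ∘-monoʳ : ∀ c → x ≤B y → (c ∘ x) ≤B (c ∘ y)
    ∘-monoʳ {x} {y} c x≤y = left-induction (λ c → (c ∘ x) ≤B (c ∘ y))
      (subst₂ _≤B_ (sym (∘-identityˡ x)) (sym (∘-identityˡ y)) x≤y)
      (λ i c lt ih → subst₂ _≤B_ (sym (gen·∘ i c x lt)) (sym (gen·∘ i c y lt)) (Left.up-mono i ih)) c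

    ·≤∘ : ∀ c a → (c · a) ≤B (c ∘ a)
    ·≤∘ c a = left-induction (λ c → (c · a) ≤B (c ∘ a))
      (≡⇒≤B (trans (·-identityˡ a) (sym (∘-identityˡ a))))
      (λ i c lt ih → subst₂ _≤B_ (sym (·-assoc _ _ _)) (sym (gen·∘ i c a lt))
        (Left.m≤up i (c · a) ◅◅ Left.up-mono i ih)) c

    ⋉-e : ∀ x → x ⋉ e ≡ x
    ⋉-e x = trans (∘-identityʳ _) (trans (cong (_∘ x) (trans (cong _⁻¹ star-e) ε⁻¹≈ε)) (∘-identityˡ x))

    -- The last letter of `w` reappears, starred, as the first letter of `star w ⁻¹`, again
    -- lengthening; the two letters act on `x ⋉ w` by `raise`.
    ⋉-asc : ∀ x w i → ℓ w < ℓ (w · gen i) → x ⋉ (w · gen i) ≡ raise i (x ⋉ w)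
    ⋉-asc x w i lt = begin
      ((star (w · gen i) ⁻¹) ∘ x) ∘ (w · gen i)     ≡⟨ cong₂ (λ c d → (c ∘ x) ∘ d) star≡ (sym (∘-right-up i w lt)) ⟩
      ((gen (i *) ∘ c) ∘ x) ∘ (w ∘ gen i)         ≡⟨ cong (_∘ (w ∘ gen i)) (∘-assoc _ _ _) ⟩
      (gen (i *) ∘ (c ∘ x)) ∘ (w ∘ gen i)         ≡⟨ ∘-assoc _ _ _ ⟩
      gen (i *) ∘ ((c ∘ x) ∘ (w ∘ gen i))         ≡⟨ cong (gen (i *) ∘_) (∘-assoc _ _ _) ⟨
      gen (i *) ∘ (((c ∘ x) ∘ w) ∘ gen i)         ≡⟨ cong (gen (i *) ∘_) (∘gen i _) ⟩
      gen (i *) ∘ Rᵐ.up i (x ⋉ w)                 ≡⟨ gen∘ (i *) _ ⟩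
      raise i (x ⋉ w)                             ∎
      where
      open ≡-Reasoning
      c = star w ⁻¹
      anti : star (w · gen i) ⁻¹ ≡ gen (i *) · c
      anti = trans (cong _⁻¹ (trans (star-hom _ _) (cong (star w ·_) (proj₂ (star-gen i)))))
                   (anti-·gen (i *) (star w))
      ℓ-star⁻¹ : ∀ v → ℓ (star v ⁻¹) ≡ ℓ v
      ℓ-star⁻¹ v = trans (ℓ-⁻¹ (star v)) (ℓ-star v)
      star≡ : star (w · gen i) ⁻¹ ≡ gen (i *) ∘ c
      star≡ = trans anti (sym (∘-left-up (i *) c
        (subst₂ _<_ (sym (ℓ-star⁻¹ w)) (trans (sym (ℓ-star⁻¹ (w · gen i))) (cong ℓ anti)) lt)))

    Inv-⋉ : Inv x → ∀ w → Inv (x ⋉ w)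
    Inv-⋉ {x} inv = right-induction _ (subst Inv (sym (⋉-e x)) inv)
      λ w i lt ih → subst Inv (sym (⋉-asc x w i lt)) (Inv-raise i ih)

    -- If `gen i` is a descent of `w`, it is absorbed by `w` and hence by `x ⋉ w`, so `raise` is
    -- trivial there. This allows letters to be appended without regard to reducedness.
    ⋉-up : Inv x → ∀ w i → x ⋉ (Rᵐ.up i w) ≡ raise i (x ⋉ w)
    ⋉-up {x} inv w i with Rᵐ.comparable i w
    ... | inj₁ s = trans (cong (x ⋉_) (Rᵐ.up-asc i s)) (⋉-asc x w i (step⇒ℓ< s))
    ... | inj₂ s = trans (cong (x ⋉_) (Rᵐ.up-desc i s)) (sym (raise-desc (Inv-⋉ inv w) (Rᵐ.up-fixed⇒desc i (begin
          Rᵐ.up i (x ⋉ w)                     ≡⟨ ∘gen i _ ⟨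
          (((star w ⁻¹) ∘ x) ∘ w) ∘ gen i       ≡⟨ ∘-assoc _ _ _ ⟩
          ((star w ⁻¹) ∘ x) ∘ (w ∘ gen i)       ≡⟨ cong (((star w ⁻¹) ∘ x) ∘_)
                                                   (trans (∘gen i w) (Rᵐ.up-desc i s)) ⟩
          x ⋉ w                               ∎))))
      where open ≡-Reasoning

    -- The Bruhat order and `ℓ̂` on twisted involutions.

    Inv-e : Inv e
    Inv-e = trans ε⁻¹≈ε (sym star-e)

    -- Graded lifting property: the Bruhat order on twisted involutions is compatible with ℓ̂.
    ≤B-⋉ : ∀ w y → Inv y → y ≤B (e ⋉ w) →
           ∃ λ w′ → ℓ w′ ≤ ℓ w × e ⋉ w′ ≡ y × (ℓ w′ ≡ ℓ w → y ≡ e ⋉ w)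
    ≤B-⋉ = right-induction _ base step
      where
      base : ∀ y → Inv y → y ≤B (e ⋉ e) → ∃ λ w′ → ℓ w′ ≤ ℓ e × e ⋉ w′ ≡ y × (ℓ w′ ≡ ℓ e → y ≡ e ⋉ e)
      base y _ y≤ = e , ≤-refl , sym y≡ , λ _ → y≡
        where
        y≡ : y ≡ e ⋉ e
        y≡ = trans (≤B-e (subst (y ≤B_) (⋉-e e) y≤)) (sym (⋉-e e))
      step : ∀ w i → ℓ w < ℓ (w · gen i) →
             (∀ y → Inv y → y ≤B (e ⋉ w) →
               ∃ λ w′ → ℓ w′ ≤ ℓ w × e ⋉ w′ ≡ y × (ℓ w′ ≡ ℓ w → y ≡ e ⋉ w)) →
             ∀ y → Inv y → y ≤B (e ⋉ (w · gen i)) →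
               ∃ λ w′ → ℓ w′ ≤ ℓ (w · gen i) × e ⋉ w′ ≡ y × (ℓ w′ ≡ ℓ (w · gen i) → y ≡ e ⋉ (w · gen i))
      step w i lt ih y inv y≤ = by-cases (Rᵐ.comparable i z) (Rᵐ.comparable i y)
        where
        z = e ⋉ w
        inv-z : Inv z
        inv-z = Inv-⋉ Inv-e w
        y≤raise : y ≤B raise i z
        y≤raise = subst (y ≤B_) (⋉-asc e w i lt) y≤
        Goal : Set
        Goal = ∃ λ w′ → ℓ w′ ≤ ℓ (w · gen i) × e ⋉ w′ ≡ y × (ℓ w′ ≡ ℓ (w · gen i) → y ≡ e ⋉ (w · gen i))
        below : y ≤B z → Goal
        below y≤z = let w′ , le , eq , _ = ih y inv y≤z in
          w′ , ≤-trans le (<⇒≤ lt) , eq , λ ℓ≡ → ⊥-elim (<-irrefl ℓ≡ (≤-<-trans le lt))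
        by-cases : Asc i z ⊎ Desc i z → Asc i y ⊎ Desc i y → Goal
        by-cases (inj₂ d) _        = below (subst (y ≤B_) (raise-desc inv-z d) y≤raise)
        -- Lowering `y ≤B raise i z` changes only the right side, to `z`.
        by-cases (inj₁ s) (inj₁ t) = below (subst₂ _≤B_ (lower-asc inv t)
          (Raised.lower-raise (asc-raised inv-z s)) (lower-mono i y≤raise))
        -- Both sides drop; the witness for `lower i y` is extended by the letter `i`.
        by-cases (inj₁ s) (inj₂ t) =
          let open Lowered (desc-lowered inv t) renaming (inv to inv-y′)
              w′ , le , eq , eq⇒ = ih (lower i y) inv-y′
                (subst (lower i y ≤B_) (Raised.lower-raise (asc-raised inv-z s)) (lower-mono i y≤raise))
          in Rᵐ.up i w′
           , ≤-trans (ℓ-up i w′) (≤-trans (s≤s le) lt)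
           , trans (⋉-up Inv-e w′ i) (trans (cong (raise i) eq) raise-lower)
           -- Appending a letter adds at most one, so equal lengths here force `ℓ w′ ≡ ℓ w` and thus
           -- `lower i y ≡ z`.
           , λ ℓ≡ → begin
               y                     ≡⟨ raise-lower ⟨
               raise i (lower i y)   ≡⟨ cong (raise i) (eq⇒ (≤-antisym le (≤-pred
                                          (≤-trans lt (≤-trans (≤-reflexive (sym ℓ≡)) (ℓ-up i w′)))))) ⟩
               raise i z             ≡⟨ ⋉-asc e w i lt ⟨
               e ⋉ (w · gen i)       ∎
          where open ≡-Reasoning

    -- The witness is the Demazure product of `w₁` and `v`, built letter by letter; hence acting by
    -- `v` raises `ℓ̂` by at most `ℓ v`.
    ⋉-⋉ : ∀ w₁ v → ∃ λ w′ → ℓ w′ ≤ ℓ w₁ + ℓ v × e ⋉ w′ ≡ (e ⋉ w₁) ⋉ v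
    ⋉-⋉ w₁ = right-induction _ (w₁ , m≤m+n _ _ , sym (⋉-e _)) λ v i lt (w′ , le , eq) →
      Rᵐ.up i w′
      , ≤-trans (ℓ-up i w′) (≤-trans (s≤s le) (≤-trans (≤-reflexive (sym (+-suc (ℓ w₁) (ℓ v)))) (+-monoʳ-≤ (ℓ w₁) lt)))
      , trans (⋉-up Inv-e w′ i) (trans (cong (raise i) eq) (sym (⋉-asc _ v i lt)))

    -- Comparison of `A` and `A′`.

    rank-Inv : ∀ {k} → ℓ̂≡ x k → Inv x
    rank-Inv ((w , refl , _) , _) = Inv-⋉ Inv-e w

    -- With `c = star v ⁻¹`, the chain is `y = c · (star v · y) ≤ c ∘ (star v · y) ≤ c ∘ (x · v) ≤ c
    -- ∘ (x ∘ v)`.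
    B′⇒≤B-⋉ : B′ x y v → y ≤B (x ⋉ v)
    B′⇒≤B-⋉ {x} {y} {v} b = subst₂ _≤B_ (\\-leftDividesʳ (star v) y) (sym (∘-assoc _ _ _))
      (·≤∘ (star v ⁻¹) (star v · y) ◅◅ ∘-monoʳ (star v ⁻¹) (b ◅◅ ·≤∘ x v))

    -- Either every letter of a reduced word of `w` is an ascent when its turn comes, or one can be
    -- omitted. The equation `x ∘ w ≡ x · w` is carried along to transfer ascents in `xw-asc`.
    reduced-or-shorter : Inv x → ∀ w →
      ((star w · (x ⋉ w)) ≤B (x · w) × x ∘ w ≡ x · w) ⊎ (∃ λ w′ → ℓ w′ < ℓ w × x ⋉ w′ ≡ x ⋉ w)
    reduced-or-shorter {x} inv = right-induction _
      (inj₁ (≡⇒≤B (trans (cong₂ _·_ star-e (⋉-e x)) (trans (·-identityˡ x) (sym (·-identityʳ x))))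
            , trans (∘-identityʳ x) (sym (·-identityʳ x))))
      step
      where
      step : ∀ w i → ℓ w < ℓ (w · gen i) → _ → _
      step w i lt (inj₂ (w′ , lt′ , eq)) = inj₂ (Rᵐ.up i w′
        , ≤-<-trans (≤-trans (ℓ-up i w′) lt′) lt
        , trans (⋉-up inv w′ i) (trans (cong (raise i) eq) (sym (⋉-asc x w i lt))))
      step w i lt (inj₁ (le , x∘w≡)) = by-cases (Rᵐ.comparable i z)
        where
        open ≡-Reasoning
        z = x ⋉ w
        c = star w ⁻¹
        inv-z : Inv z
        inv-z = Inv-⋉ inv w
        Goal : Set
        Goal = ((star (w · gen i) · (x ⋉ (w · gen i))) ≤B (x · (w · gen i)) × x ∘ (w · gen i) ≡ x · (w · gen i))
             ⊎ (∃ λ w′ → ℓ w′ < ℓ (w · gen i) × x ⋉ w′ ≡ x ⋉ (w · gen i))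
        x∘ws≡ : x ∘ (w · gen i) ≡ Rᵐ.up i (x · w)
        x∘ws≡ = begin
          x ∘ (w · gen i)    ≡⟨ cong (x ∘_) (∘-right-up i w lt) ⟨
          x ∘ (w ∘ gen i)    ≡⟨ ∘-assoc _ _ _ ⟨
          (x ∘ w) ∘ gen i    ≡⟨ ∘gen i _ ⟩
          Rᵐ.up i (x ∘ w)    ≡⟨ cong (Rᵐ.up i) x∘w≡ ⟩
          Rᵐ.up i (x · w)    ∎
        -- A descent of `x · w`, which equals `x ∘ w`, would be absorbed by `x ∘ w` and so by `z`.
        xw-asc : Asc i z → Asc i (x · w)
        xw-asc s with Rᵐ.comparable i (x · w)
        ... | inj₁ s′ = s′
        ... | inj₂ d  = ⊥-elim (step-irrefl s (Rᵐ.up-fixed⇒desc i (begin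
          Rᵐ.up i z                   ≡⟨ ∘gen i z ⟨
          ((c ∘ x) ∘ w) ∘ gen i       ≡⟨ cong (_∘ gen i) (∘-assoc _ _ _) ⟩
          (c ∘ (x ∘ w)) ∘ gen i       ≡⟨ ∘-assoc _ _ _ ⟩
          c ∘ ((x ∘ w) ∘ gen i)       ≡⟨ cong (c ∘_) (∘gen i _) ⟩
          c ∘ Rᵐ.up i (x ∘ w)         ≡⟨ cong (c ∘_) (trans (cong (Rᵐ.up i) x∘w≡)
                                           (trans (Rᵐ.up-desc i d) (sym x∘w≡))) ⟩
          c ∘ (x ∘ w)                 ≡⟨ ∘-assoc _ _ _ ⟨
          z                           ∎)))
        star-shift : ∀ v → star (w · gen i) · v ≡ star w · (star (gen i) · v)
        star-shift v = trans (cong (_· v) (star-hom _ _)) (·-assoc _ _ _)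
        star-gen-cancel : ∀ v → star (gen i) · (star (gen i) · v) ≡ v
        star-gen-cancel v = subst (λ g → g · (g · v) ≡ v) (sym (proj₂ (star-gen i))) (gen-cancelˡ (i *) v)
        bound : Asc i z → (star (w · gen i) · raise i z) ≤B ((x · w) · gen i)
        bound s with Raised.act (asc-raised inv-z s)
        -- In the commuting case the new letter cancels on the left, leaving `star w · z`.
        ... | inj₂ (comm , eq) = ≡⇒≤B (begin
                star (w · gen i) · raise i z            ≡⟨ cong (star (w · gen i) ·_) (trans eq (sym comm)) ⟩
                star (w · gen i) · (star (gen i) · z)   ≡⟨ star-shift _ ⟩
                star w · (star (gen i) · (star (gen i) · z)) ≡⟨ cong (star w ·_) (star-gen-cancel z) ⟩
                star w · z                              ∎)
              ◅◅ le ◅◅ step⇒≤B (xw-asc s)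
        -- Otherwise `gen i` remains on the right, and `Rᵐ.up-mono` extends the induction hypothesis
        -- by it.
        ... | inj₁ (_ , eq) = ≡⇒≤B (begin
                star (w · gen i) · raise i z
                  ≡⟨ cong (star (w · gen i) ·_) (trans eq (·-assoc _ _ _)) ⟩
                star (w · gen i) · (star (gen i) · (z · gen i))
                  ≡⟨ star-shift _ ⟩
                star w · (star (gen i) · (star (gen i) · (z · gen i)))
                  ≡⟨ cong (star w ·_) (star-gen-cancel _) ⟩
                star w · (z · gen i)
                  ≡⟨ ·-assoc _ _ _ ⟨
                (star w · z) · gen i ∎)
              ◅◅ Rᵐ.m≤up i (star w · z) ◅◅ Rᵐ.up-mono i le ◅◅ ≡⇒≤B (Rᵐ.up-asc i (xw-asc s))
        by-cases : Asc i z ⊎ Desc i z → Goal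
        -- A letter that is a descent of `z` changes nothing, so `w` itself is the shorter element.
        by-cases (inj₂ d) = inj₂ (w , lt , sym (trans (⋉-asc x w i lt) (raise-desc inv-z d)))
        by-cases (inj₁ s) = inj₁
          ( subst₂ _≤B_ (cong (star (w · gen i) ·_) (sym (⋉-asc x w i lt))) (·-assoc x w (gen i)) (bound s)
          , trans x∘ws≡ (trans (Rᵐ.up-asc i (xw-asc s)) (·-assoc x w (gen i))))

    -- At a descent the step would lead to `lower i x`, which lies below `x`; by `≤B-⋉` its `ℓ̂`
    -- could not exceed that of `x`.
    TStep⇒raise : (s : TStep x y) → ∃ λ i → y ≡ raise i x
    TStep⇒raise {x} {y} (inv , (i , act) , a , b , ((w , refl , refl) , _) , (_ , b-min) , a<b)
      with Rᵐ.comparable i x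
    ... | inj₁ s = i , IsTwistedAct-unique act (Raised.act (asc-raised inv s))
    ... | inj₂ s = ⊥-elim (<-irrefl refl (<-≤-trans a<b (≤-trans (b-min w′ (trans eq (sym y≡))) le)))
      where
      open Lowered (desc-lowered inv s) renaming (act to act′; inv to inv′)
      y≡ : y ≡ lower i x
      y≡ = IsTwistedAct-unique act act′
      lifted = ≤B-⋉ w (lower i x) inv′ (lower≤ i x)
      w′ = proj₁ lifted
      le = proj₁ (proj₂ lifted)
      eq = proj₁ (proj₂ (proj₂ lifted))

    ℓ̂-unique : ∀ {k l} → ℓ̂≡ x k → ℓ̂≡ x l → k ≡ l
    ℓ̂-unique ((w , p , refl) , k-min) ((w′ , p′ , refl) , l-min) = ≤-antisym (k-min w′ p′) (l-min w p)

    -- Each step of the chain extends `u` by at most one letter and raises `ℓ̂` by at least one.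
    ≤T⇒B : Inv x → ∀ {a} → ℓ̂≡ x a → x ≤T y → ∃ λ u → ∃ λ b → B x y u × ℓ̂≡ y b × a + ℓ u ≤ b
    ≤T⇒B {x} inv {a} rank = go (e , a , ⋉-e x , rank ,
        ≤-reflexive (trans (cong (a +_) ℓ-e) (+-identityʳ a)))
      where
      Reached : W → Set
      Reached y = ∃ λ u → ∃ λ b → B x y u × ℓ̂≡ y b × a + ℓ u ≤ b
      go : Reached y → y ≤T v → Reached v
      go r done = r
      go (u , b , refl , rank-y , le) (s@(_ , _ , b₁ , b₂ , rank₁ , rank₂ , b₁<b₂) ◅ ss)
        with TStep⇒raise s
      ... | i , refl = go (Rᵐ.up i u , b₂ , ⋉-up inv u i , rank₂ ,
        ≤-trans (+-monoʳ-≤ a (ℓ-up i u)) (≤-trans (≤-reflexive (+-suc a (ℓ u)))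
          (≤-trans (s≤s le) (subst (_< b₂) (ℓ̂-unique rank₁ rank-y) b₁<b₂)))) ss

    -- The element `u` from `≤T⇒B` attains the common minimal length of `B x y` and `B′ x y`.
    A⇔A′ : Inv x → ∀ {k} → ℓ̂≡ x k → x ≤T y → ∀ w → A x y w ⇔ A′ x y w
    A⇔A′ {x} {y} inv rank@((w₁ , refl , refl) , _) x≤y w with ≤T⇒B inv rank x≤y
    ... | u , b , u∈B , rank-y , ℓw₁+ℓu≤b = mk⇔ to from
      where
      -- Here `w₂` produces `x ⋉ v` and `w₃` produces `y`, so
      -- `ℓ w₁ + ℓ u ≤ ℓ w₃ ≤ ℓ w₂ ≤ ℓ w₁ + ℓ v`. If `ℓ v ≤ ℓ u`, all are equal and the equality
      -- clause of `≤B-⋉` applies.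
      minimal : ∀ v → y ≤B (x ⋉ v) → ℓ u ≤ ℓ v × (ℓ v ≤ ℓ u → B x y v)
      minimal v y≤ with ⋉-⋉ w₁ v
      ... | w₂ , le₂ , eq₂ with ≤B-⋉ w₂ y (rank-Inv rank-y) (subst (y ≤B_) (sym eq₂) y≤)
      ... | w₃ , le₃ , eq₃ , eq⇒ = +-cancelˡ-≤ (ℓ w₁) _ _ (≤-trans lower-bound (≤-trans le₃ le₂))
          , λ ℓv≤ → trans (sym eq₂) (sym (eq⇒ (≤-antisym le₃
              (≤-trans le₂ (≤-trans (+-monoʳ-≤ (ℓ w₁) ℓv≤) lower-bound)))))
        where
        lower-bound : ℓ w₁ + ℓ u ≤ ℓ w₃
        lower-bound = ≤-trans ℓw₁+ℓu≤b (proj₂ rank-y w₃ eq₃)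

      A⊆B′ : ∀ {v} → A x y v → B′ x y v
      A⊆B′ {v} (refl , v-min) with reduced-or-shorter inv v
      ... | inj₁ (le , _) = le
      ... | inj₂ (v′ , lt , eq) = ⊥-elim (<⇒≱ lt (v-min v′ eq))

      u-min : ∀ v → B x y v → ℓ u ≤ ℓ v
      u-min v eq = proj₁ (minimal v (≡⇒≤B (sym eq)))

      to : A x y w → A′ x y w
      to w∈A = A⊆B′ w∈A , λ v v∈B′ →
        ≤-trans (proj₂ w∈A u u∈B) (proj₁ (minimal v (B′⇒≤B-⋉ v∈B′)))

      from : A′ x y w → A x y w
      from (w∈B′ , w-min) = proj₂ (minimal w (B′⇒≤B-⋉ w∈B′)) ℓw≤ , λ v v∈B → ≤-trans ℓw≤ (u-min v v∈B)
        where
        ℓw≤ : ℓ w ≤ ℓ u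
        -- `u` lies in `A x y`, hence in `B′ x y`, where `w` is minimal.
        ℓw≤ = w-min u (A⊆B′ (u∈B , u-min))

  -- The axioms do not force e ∘ e ≡ e: in rank one, the constant product with value the
  -- generator satisfies them too.  No other product has e ∘ e ≢ e.
  module Degenerate (nonidem : e ∘ e ≢ e) where

    gen∘e : ∀ i → gen i ∘ e ≡ gen i
    gen∘e i = trans (∘-left-up i e (N-false⇒ℓ< (gen-reflection i) (N-e _))) (·-identityʳ _)

    e∘gen : ∀ i → e ∘ gen i ≡ gen i
    e∘gen i = trans (∘-right-up i e (subst (λ v → ℓ e < ℓ v)
                (trans (·-identityʳ _) (sym (·-identityˡ _))) (N-false⇒ℓ< (gen-reflection i) (N-e _))))
                (·-identityˡ _)

    -- Associativity gives `gen i ∘ (e ∘ e) ≡ gen i`. An ascent would cancel to `e ∘ e ≡ e`; at a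
    -- descent the left side is `e ∘ e`.
    gen≡e∘e : ∀ i → gen i ≡ e ∘ e
    gen≡e∘e i with Left.comparable i (e ∘ e) | trans (sym (∘-assoc _ _ _)) (trans (cong (_∘ e) (gen∘e i)) (gen∘e i))
    ... | inj₁ s | absorb = ⊥-elim (nonidem (identityʳ-unique _ _
                              (trans (sym (Left.up-asc i s)) (trans (sym (gen∘ i _)) absorb))))
    ... | inj₂ s | absorb = trans (sym absorb) (trans (gen∘ i _) (Left.up-desc i s))

    gen∘gen : ∀ i → gen i ∘ gen i ≡ gen i
    gen∘gen i = ∘-left-down i (gen i) λ lt → <⇒≱ lt
      (subst (_≤ ℓ (gen i)) (trans (sym ℓ-e) (cong ℓ (sym (gen-involution i)))) z≤n)

    -- All generators equal `e ∘ e`, so a product of two of them is `e`.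
    e-or-gen : ∀ w → w ≡ e ⊎ ∃ λ i → w ≡ gen i
    e-or-gen = left-induction _ (inj₁ refl) λ where
      i w _ (inj₁ refl)       → inj₂ (i , ·-identityʳ _)
      i w _ (inj₂ (j , refl)) → inj₁ (trans (cong (gen i ·_) (trans (gen≡e∘e j) (sym (gen≡e∘e i)))) (gen-involution i))

    ∘-constant : ∀ v w → v ∘ w ≡ e ∘ e
    ∘-constant v w with e-or-gen v | e-or-gen w
    ... | inj₁ refl       | inj₁ refl       = refl
    ... | inj₁ refl       | inj₂ (j , refl) = trans (e∘gen j) (gen≡e∘e j)
    ... | inj₂ (i , refl) | inj₁ refl       = trans (gen∘e i) (gen≡e∘e i)
    ... | inj₂ (i , refl) | inj₂ (j , refl) =
      trans (cong (gen i ∘_) (trans (gen≡e∘e j) (sym (gen≡e∘e i)))) (trans (gen∘gen i) (gen≡e∘e i))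

    rank≡0 : ∀ {k} → ℓ̂≡ x k → x ≡ e ∘ e × k ≡ 0
    rank≡0 ((w , refl , _) , k-min) = ∘-constant _ w
      , n≤0⇒n≡0 (≤-trans (k-min e (trans (∘-constant _ e) (sym (∘-constant _ w)))) (≤-reflexive ℓ-e))

    ≤T⇒≡ : x ≤T y → x ≡ y
    ≤T⇒≡ done = refl
    ≤T⇒≡ ((_ , _ , _ , _ , _ , rank , a<b) ◅ _) = ⊥-elim (n≮0 (subst (_ <_) (proj₂ (rank≡0 rank)) a<b))

    -- `ℓ̂` is 0 wherever it has a value, so `≤T` is equality, and `A x x` and `A′ x x` both consist
    -- of `e` alone.
    A⇔A′ : ∀ {k} → ℓ̂≡ x k → x ≤T y → ∀ w → A x y w ⇔ A′ x y w
    A⇔A′ {x} rank x≤y w with ≤T⇒≡ x≤y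
    ... | refl = mk⇔
        (λ (_ , w-min) → A′-e (only-e (w-min e e∈B)))
        (λ (_ , w-min) → A-e (only-e (w-min e e∈B′)))
      where
      e∈B : B x x e
      e∈B = trans (∘-constant _ e) (sym (proj₁ (rank≡0 rank)))
      e∈B′ : B′ x x e
      e∈B′ = ≡⇒≤B (trans (cong (_· x) star-e) (trans (·-identityˡ x) (sym (·-identityʳ x))))
      only-e : ℓ w ≤ ℓ e → w ≡ e
      only-e le = ℓ≡0⇒≡e (n≤0⇒n≡0 (≤-trans le (≤-reflexive ℓ-e)))
      ℓ-e≤ : ∀ v → ℓ e ≤ ℓ v
      ℓ-e≤ v = subst (_≤ ℓ v) (sym ℓ-e) z≤n
      A-e : w ≡ e → A x x w
      A-e refl = e∈B , λ v _ → ℓ-e≤ v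
      A′-e : w ≡ e → A′ x x w
      A′-e refl = e∈B′ , λ v _ → ℓ-e≤ v

  -- A nonempty chain records `ℓ̂` at its start in its first step; along the empty chain `x` and `y`
  -- coincide.
  ≤T-rank : x ≤T y → (∃ (ℓ̂≡ x)) ⊎ (∃ (ℓ̂≡ y)) → ∃ (ℓ̂≡ x)
  ≤T-rank _ (inj₁ rank) = rank
  ≤T-rank done (inj₂ rank) = rank
  ≤T-rank ((_ , _ , a , _ , rank , _) ◅ _) (inj₂ _) = a , rank

theorem4p13 : (C : TwistedCoxeterSystem) (D : DemazureProduct C) →
    let open TwistedCoxeterSystem C in
    let open Twisted C D in
    IsFinite → (w₀ : W) → IsLongest w₀ →
    (x y : W) → Inv x → Inv y → x ≤T y →
    (ℓ̂≡ x (ℓ x) ⊎ (∃ λ a → ∃ λ b → ℓ̂≡ w₀ a × ℓ̂≡ y b × (ℓ w₀ + b ≡ a + ℓ y))) →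
    ∀ w → A x y w ⇔ A′ x y w
theorem4p13 C D _ _ _ x y inv-x _ x≤y hyp = by-cases ((e ∘ e) ≟ e)
  where
  open TwistedCoxeterSystem C
  open DemazureProduct D
  open Twisted C D
  open Coxeter C using (_≟_)
  open TwistedInvolutions C D
  rank : ∃ (ℓ̂≡ x)
  rank = ≤T-rank x≤y ([ (λ r → inj₁ (_ , r)) , (λ (_ , b , _ , r , _) → inj₂ (b , r)) ]′ hyp)
  by-cases : Dec (e ∘ e ≡ e) → ∀ w → A x y w ⇔ A′ x y w
  by-cases (yes idem)   = Identity.A⇔A′ idem inv-x (proj₂ rank) x≤y
  by-cases (no nonidem) = Degenerate.A⇔A′ nonidem (proj₂ rank) x≤y
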